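{- Let $m$ be a positive integer. In each of the following cases the displayed identity holds, and the triple consisting of $n_1=6m+6$ and the denominators $n_2,n_3$ of the second and third unit fractions on the right-hand side is a wild solution of the Erdős–Straus equation for $24m+1$. (1) If $m=46r+14+c(46r+15)$ with $r,c\in\mathbb N$, then $$\frac{4}{24m+1}=\frac{1}{6m+6}+\frac{1}{4(3r+1)(c+1)(24m+1)}+\frac{1}{12(3r+1)(c+1)(46r+15)(24m+1)}.$$ (2) If $m=138r-2+c(138r-1)$ with $r\in\mathbb N$, $r>0$, $c\in\mathbb N$, then $$\frac{4}{24m+1}=\frac{1}{6m+6}+\frac{1}{36r(c+1)(24m+1)}+\frac{1}{36r(c+1)(138r-1)(24m+1)}.$$ (3) If $m=138r+90+c(138r+91)$ with $r,c\in\mathbb N$, then $$\frac{4}{24m+1}=\frac{1}{6m+6}+\frac{1}{12(3r+2)(c+1)(24m+1)}+\frac{1}{12(3r+2)(c+1)(138r+91)(24m+1)}.$$ (4) If $m=138r+42+c(138r+43)$ with $r,c\in\mathbb N$, then $$\frac{4}{24m+1}=\frac{1}{6m+6}+\frac{1}{12(3r+1)(c+1)(24m+1)}+\frac{1}{4(3r+1)(c+1)(138r+43)(24m+1)}.$$ (5) If $m=138r+88+c(138r+89)$ with $r,c\in\mathbb N$, then $$\frac{4}{24m+1}=\frac{1}{6m+6}+\frac{1}{12(3r+2)(c+1)(24m+1)}+\frac{1}{4(3r+2)(c+1)(138r+89)(24m+1)}.$$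
   Context: $\mathbb N$ denotes the set of nonnegative integers. For a positive integer $m$, the Erdős–Straus equation for $n=24m+1$ is $\frac{4}{n}=\frac1{n_1}+\frac1{n_2}+\frac1{n_3}$ in positive integers $n_1,n_2,n_3$. For $n_1=6m+k$ with $1\le k\le 12m$ one has $\frac{4}{24m+1}=\frac{1}{6m+k}+\frac{4k-1}{(6m+k)(24m+1)}$. A solution $(n_1,n_2,n_3)$ is called a wild solution if $n_1=6m+k$ for some integer $1\le k\le 12m$ and there exist an integer $L\ge 2$ (called a multiplier) and positive integers $J_1,J_2$ (called the numerator summands) such that $J_1+J_2=L(4k-1)$, $\gcd(L,J_1,J_2)=1$, $\frac1{n_2}=\frac{J_1}{L(6m+k)(24m+1)}$ and $\frac1{n_3}=\frac{J_2}{L(6m+k)(24m+1)}$. -}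

module Defs where

open import Data.Nat using (ℕ; _+_; _*_; _∸_; _≤_; NonZero; >-nonZero)
open import Data.Nat.GCD using (gcd)
open import Data.Nat.Properties using (m*n≢0; ≤-trans; m≤n+m; n≤1+n)
open import Data.Integer using (+_)
open import Data.Rational using (_/_) renaming (_+_ to _+ℚ_)
open import Relation.Binary.PropositionalEquality using (_≡_)

infix 4 4/_≡1/_+1/_+1/_

-- Positivity of the denominators is part of the claim, so that
-- `4/ n ≡1/ n₁ +1/ n₂ +1/ n₃` can be written without supplying it beforehand.
record 4/_≡1/_+1/_+1/_ (n n₁ n₂ n₃ : ℕ) : Set where
  field
    {{n≢0}}  : NonZero n
    {{n₁≢0}} : NonZero n₁
    {{n₂≢0}} : NonZero n₂
    {{n₃≢0}} : NonZero n₃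
    identity : + 4 / n ≡ (+ 1 / n₁) +ℚ (+ 1 / n₂) +ℚ (+ 1 / n₃)

denominator : (m k L : ℕ) → ℕ
denominator m k L = L * (6 * m + k) * (24 * m + 1)

denominator≢0 : ∀ m {k L} → 1 ≤ k → 2 ≤ L → NonZero (denominator m k L)
denominator≢0 m {k} {L} 1≤k 2≤L = m*n≢0 (L * (6 * m + k)) (24 * m + 1)
  where instance
    L≢0       = >-nonZero (≤-trans (n≤1+n 1) 2≤L)
    6m+k≢0    = >-nonZero (≤-trans 1≤k (m≤n+m k (6 * m)))
    24m+1≢0   = >-nonZero (m≤n+m 1 (24 * m))
    L[6m+k]≢0 = m*n≢0 L (6 * m + k)

record WildSolution (m n₁ n₂ n₃ : ℕ) : Set where
  field
    solution : 4/ (24 * m + 1) ≡1/ n₁ +1/ n₂ +1/ n₃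

    k        : ℕ
    1≤k      : 1 ≤ k
    k≤12m    : k ≤ 12 * m
    n₁≡6m+k  : n₁ ≡ 6 * m + k

    L J₁ J₂  : ℕ
    2≤L      : 2 ≤ L
    1≤J₁     : 1 ≤ J₁
    1≤J₂     : 1 ≤ J₂
    -- ∸ does not truncate here, as 1 ≤ k.
    summands : J₁ + J₂ ≡ L * (4 * k ∸ 1)
    coprime  : gcd L (gcd J₁ J₂) ≡ 1

  open 4/_≡1/_+1/_+1/_ solution using (n₂≢0; n₃≢0)

  field
    1/n₂≡ : (+ 1 / n₂) {{n₂≢0}} ≡ (+ J₁ / denominator m k L) {{denominator≢0 m 1≤k 2≤L}}
    1/n₃≡ : (+ 1 / n₃) {{n₃≢0}} ≡ (+ J₂ / denominator m k L) {{denominator≢0 m 1≤k 2≤L}}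

{-# OPTIONS --safe #-}
-- For k = 6 one has 4k ∸ 1 = 23 and n₁ = 6(m + 1).  Each family is chosen so that
-- m + 1 = (c + 1) q, where q + 1, q + 3 or 3q + 1 equals 46 s = 23 L with L = 2 s.  The
-- two terms of that sum are the numerator summands: both divide L (6m + 6)(24m + 1).
module Submission where

open import Defs
open import Data.Nat using (ℕ; suc; _+_; _*_; _∸_; _≤_; _<_; NonZero; >-nonZero; z≤n; s≤s)
open import Data.Nat.Coprimality using (Coprime; coprime⇒gcd≡1; gcd≡1⇒coprime)
open import Data.Nat.Divisibility using (∣m+n∣m⇒∣n; ∣n⇒∣m*n)
open import Data.Nat.GCD using (gcd; gcd-zeroʳ)
open import Data.Nat.Properties
open import Data.Nat.Tactic.RingSolver using (solve-∀)
open import Data.Integer using (+_)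
import Data.Integer as ℤ
import Data.Integer.Properties as ℤ
open import Data.Product using (_×_; _,_)
open import Data.Rational using (_/_; fromℚᵘ; toℚᵘ) renaming (_+_ to _+ℚ_)
open import Data.Rational.Properties using (fromℚᵘ-cong; toℚᵘ-fromℚᵘ; toℚᵘ-homo-+; toℚᵘ-injective)
import Data.Rational.Unnormalised as ℚᵘ
import Data.Rational.Unnormalised.Properties as ℚᵘ
open import Relation.Binary.PropositionalEquality using (_≡_; refl; sym; trans; cong; cong₂; subst; module ≡-Reasoning)

-- Cross-multiplication. Once both denominators are matched as `suc`, each side is definitionally
-- `fromℚᵘ` of an unnormalised fraction, so reduction to lowest terms never has to be unfolded.
fraction-cong : ∀ a b c d .{{_ : NonZero b}} .{{_ : NonZero d}} →
  a * d ≡ c * b → + a / b ≡ + c / d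
fraction-cong a (suc b) c (suc d) ad≡cb = fromℚᵘ-cong {ℚᵘ.mkℚᵘ (+ a) b} {ℚᵘ.mkℚᵘ (+ c) d} (ℚᵘ.*≡* (begin
  + a ℤ.* + suc d  ≡⟨ ℤ.pos-* a (suc d) ⟨
  + (a * suc d)    ≡⟨ cong +_ ad≡cb ⟩
  + (c * suc b)    ≡⟨ ℤ.pos-* c (suc b) ⟩
  + c ℤ.* + suc b  ∎))
  where open ≡-Reasoning

-- Additivity is known for `toℚᵘ`, which is injective and undoes `fromℚᵘ` up to equivalence, so it
-- transfers to `fromℚᵘ`.
fromℚᵘ-homo-+ : ∀ p q → fromℚᵘ p +ℚ fromℚᵘ q ≡ fromℚᵘ (p ℚᵘ.+ q)
fromℚᵘ-homo-+ p q = toℚᵘ-injective (begin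
  toℚᵘ (fromℚᵘ p +ℚ fromℚᵘ q)            ≈⟨ toℚᵘ-homo-+ (fromℚᵘ p) (fromℚᵘ q) ⟩
  toℚᵘ (fromℚᵘ p) ℚᵘ.+ toℚᵘ (fromℚᵘ q)  ≈⟨ ℚᵘ.+-cong (toℚᵘ-fromℚᵘ p) (toℚᵘ-fromℚᵘ q) ⟩
  p ℚᵘ.+ q                               ≈⟨ toℚᵘ-fromℚᵘ (p ℚᵘ.+ q) ⟨
  toℚᵘ (fromℚᵘ (p ℚᵘ.+ q))               ∎)
  where open import Relation.Binary.Reasoning.Setoid ℚᵘ.≃-setoid

fraction-+ : ∀ a b d .{{_ : NonZero d}} → (+ a / d) +ℚ (+ b / d) ≡ + (a + b) / d
fraction-+ a b (suc d) = trans
  (fromℚᵘ-homo-+ p q)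
  (fromℚᵘ-cong {p ℚᵘ.+ q} {ℚᵘ.mkℚᵘ (+ (a + b)) d} (ℚᵘ.*≡* (begin
    -- Unnormalised addition puts the sum over `D * D` even for equal denominators; the extra factor
    -- `D` is moved across here.
    (+ a ℤ.* D ℤ.+ + b ℤ.* D) ℤ.* D  ≡⟨ cong (ℤ._* D) (ℤ.*-distribʳ-+ D (+ a) (+ b)) ⟨
    + (a + b) ℤ.* D ℤ.* D            ≡⟨ ℤ.*-assoc (+ (a + b)) D D ⟩
    + (a + b) ℤ.* (D ℤ.* D)          ∎)))
  where
  open ≡-Reasoning
  p = ℚᵘ.mkℚᵘ (+ a) d
  q = ℚᵘ.mkℚᵘ (+ b) d
  D = + suc d

-- The unit-fraction identity follows from the other data: over the common denominator `D` the three
-- terms have numerators `L * N`, `J₁` and `J₂`, and these add up to `4 * L * n₁`. The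
-- factorisations `J₁ * n₂` and `J₂ * n₃` of `D` are what make the last two terms unit fractions.
wildSolution : ∀ m k L J₁ J₂ n₂ n₃ → 1 ≤ k → k ≤ 12 * m → 2 ≤ L → 1 ≤ J₁ → 1 ≤ J₂ →
  J₁ + J₂ ≡ L * (4 * k ∸ 1) → gcd L (gcd J₁ J₂) ≡ 1 →
  denominator m k L ≡ J₁ * n₂ → denominator m k L ≡ J₂ * n₃ →
  WildSolution m (6 * m + k) n₂ n₃
wildSolution m k L J₁ J₂ n₂ n₃ 1≤k k≤12m 2≤L 1≤J₁ 1≤J₂ summands coprime D≡J₁n₂ D≡J₂n₃ = record
  { solution = record { identity = identity }
  ; k = k ; 1≤k = 1≤k ; k≤12m = k≤12m ; n₁≡6m+k = refl
  ; L = L ; J₁ = J₁ ; J₂ = J₂ ; 2≤L = 2≤L ; 1≤J₁ = 1≤J₁ ; 1≤J₂ = 1≤J₂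
  ; summands = summands ; coprime = coprime
  ; 1/n₂≡ = 1/n₂≡ ; 1/n₃≡ = 1/n₃≡
  }
  where
  n₁ = 6 * m + k
  N = 24 * m + 1
  D = denominator m k L
  instance
    D≢0 : NonZero D
    D≢0 = denominator≢0 m 1≤k 2≤L
    N≢0 : NonZero N
    N≢0 = >-nonZero (m≤n+m 1 (24 * m))
    n₁≢0 : NonZero n₁
    n₁≢0 = >-nonZero (≤-trans 1≤k (m≤n+m k (6 * m)))
    n₂≢0 : NonZero n₂
    -- A divisor of the nonzero `D` is nonzero.
    n₂≢0 = m*n≢0⇒n≢0 J₁ {{subst NonZero D≡J₁n₂ D≢0}}
    n₃≢0 : NonZero n₃
    n₃≢0 = m*n≢0⇒n≢0 J₂ {{subst NonZero D≡J₂n₃ D≢0}}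

  1/n₂≡ : + 1 / n₂ ≡ + J₁ / D
  1/n₂≡ = fraction-cong 1 n₂ J₁ D (trans (*-identityˡ D) D≡J₁n₂)
  1/n₃≡ : + 1 / n₃ ≡ + J₂ / D
  1/n₃≡ = fraction-cong 1 n₃ J₂ D (trans (*-identityˡ D) D≡J₂n₃)
  1/n₁≡ : + 1 / n₁ ≡ + (L * N) / D
  1/n₁≡ = fraction-cong 1 n₁ (L * N) D (rearrange L n₁ N)
    where
    rearrange : ∀ x y z → 1 * (x * y * z) ≡ x * z * y
    rearrange = solve-∀

  4n₁≡N+4k∸1 : 4 * n₁ ≡ N + (4 * k ∸ 1)
  4n₁≡N+4k∸1 = begin
    4 * (6 * m + k)                ≡⟨ *-distribˡ-+ 4 (6 * m) k ⟩
    -- The subtraction is exact since `1 ≤ k ≤ 4 * k`.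
    4 * (6 * m) + 4 * k            ≡⟨ cong₂ _+_ (sym (*-assoc 4 6 m)) (sym (m+[n∸m]≡n (≤-trans 1≤k (m≤m+n k (3 * k))))) ⟩
    24 * m + (1 + (4 * k ∸ 1))     ≡⟨ +-assoc (24 * m) 1 (4 * k ∸ 1) ⟨
    N + (4 * k ∸ 1)                ∎
    where open ≡-Reasoning

  numerators : 4 * D ≡ (L * N + J₁ + J₂) * N
  numerators = begin
    4 * (L * n₁ * N)                  ≡⟨ rearrange L n₁ N ⟩
    L * (4 * n₁) * N                  ≡⟨ cong (λ x → L * x * N) 4n₁≡N+4k∸1 ⟩
    L * (N + (4 * k ∸ 1)) * N         ≡⟨ cong (_* N) (*-distribˡ-+ L N (4 * k ∸ 1)) ⟩
    (L * N + L * (4 * k ∸ 1)) * N     ≡⟨ cong (λ x → (L * N + x) * N) summands ⟨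
    (L * N + (J₁ + J₂)) * N           ≡⟨ cong (_* N) (+-assoc (L * N) J₁ J₂) ⟨
    (L * N + J₁ + J₂) * N             ∎
    where
    open ≡-Reasoning
    rearrange : ∀ x y z → 4 * (x * y * z) ≡ x * (4 * y) * z
    rearrange = solve-∀

  identity : + 4 / N ≡ (+ 1 / n₁) +ℚ (+ 1 / n₂) +ℚ (+ 1 / n₃)
  identity = begin
    + 4 / N                                      ≡⟨ fraction-cong 4 N (L * N + J₁ + J₂) D numerators ⟩
    + (L * N + J₁ + J₂) / D                      ≡⟨ fraction-+ (L * N + J₁) J₂ D ⟨
    (+ (L * N + J₁) / D) +ℚ (+ J₂ / D)           ≡⟨ cong (_+ℚ (+ J₂ / D)) (fraction-+ (L * N) J₁ D) ⟨
    (+ (L * N) / D) +ℚ (+ J₁ / D) +ℚ (+ J₂ / D)  ≡⟨ cong₂ _+ℚ_ (cong₂ _+ℚ_ 1/n₁≡ 1/n₂≡) 1/n₃≡ ⟨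
    (+ 1 / n₁) +ℚ (+ 1 / n₂) +ℚ (+ 1 / n₃)       ∎
    where open ≡-Reasoning

-- From `m + 1 = (c + 1) * q` the common denominator is `12 * s * q * (c + 1) * N`. Here `J₁` is
-- divided out of `12 * s * q` with quotient `a`, while `J₂` is divided out of `12 * s` alone, so
-- `q` survives in `n₃`.
wildSolution-k=6 : ∀ {m p q c} s J₁ J₂ a b → 1 ≤ m → m ≡ p + c * q → p + 1 ≡ q →
  1 ≤ s → 1 ≤ J₁ → 1 ≤ J₂ → J₁ + J₂ ≡ 46 * s → gcd J₁ J₂ ≡ 1 →
  12 * s * q ≡ J₁ * a → 12 * s ≡ J₂ * b →
  let n₂ = a * (c + 1) * (24 * m + 1)
      n₃ = b * (c + 1) * q * (24 * m + 1)
  in (4/ (24 * m + 1) ≡1/ (6 * m + 6) +1/ n₂ +1/ n₃) × WildSolution m (6 * m + 6) n₂ n₃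
wildSolution-k=6 {m} {p} {q} {c} s J₁ J₂ a b 1≤m m≡ p+1≡q 1≤s 1≤J₁ 1≤J₂ J₁+J₂≡46s coprime J₁a≡ J₂b≡ =
  WildSolution.solution wild , wild
  where
  open ≡-Reasoning
  N = 24 * m + 1

  6m+6≡ : 6 * m + 6 ≡ 6 * ((c + 1) * q)
  6m+6≡ = begin
    6 * m + 6                ≡⟨ cong (λ x → 6 * x + 6) m≡ ⟩
    6 * (p + c * q) + 6      ≡⟨ expand p (c * q) ⟩
    6 * (p + 1 + c * q)      ≡⟨ cong (λ x → 6 * (x + c * q)) p+1≡q ⟩
    6 * (q + c * q)          ≡⟨ collect q c ⟩
    6 * ((c + 1) * q)        ∎
    where
    expand : ∀ x y → 6 * (x + y) + 6 ≡ 6 * (x + 1 + y)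
    expand = solve-∀
    collect : ∀ x y → 6 * (x + y * x) ≡ 6 * ((y + 1) * x)
    collect = solve-∀

  D≡J₁n₂ : denominator m 6 (2 * s) ≡ J₁ * (a * (c + 1) * N)
  D≡J₁n₂ = begin
    2 * s * (6 * m + 6) * N          ≡⟨ cong (λ x → 2 * s * x * N) 6m+6≡ ⟩
    2 * s * (6 * ((c + 1) * q)) * N  ≡⟨ collect s c q N ⟩
    12 * s * q * ((c + 1) * N)       ≡⟨ cong (_* ((c + 1) * N)) J₁a≡ ⟩
    J₁ * a * ((c + 1) * N)           ≡⟨ regroup J₁ a c N ⟩
    J₁ * (a * (c + 1) * N)           ∎
    where
    collect : ∀ s c q n → 2 * s * (6 * ((c + 1) * q)) * n ≡ 12 * s * q * ((c + 1) * n)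
    collect = solve-∀
    regroup : ∀ j a c n → j * a * ((c + 1) * n) ≡ j * (a * (c + 1) * n)
    regroup = solve-∀

  D≡J₂n₃ : denominator m 6 (2 * s) ≡ J₂ * (b * (c + 1) * q * N)
  D≡J₂n₃ = begin
    2 * s * (6 * m + 6) * N          ≡⟨ cong (λ x → 2 * s * x * N) 6m+6≡ ⟩
    2 * s * (6 * ((c + 1) * q)) * N  ≡⟨ collect s c q N ⟩
    12 * s * ((c + 1) * q * N)       ≡⟨ cong (_* ((c + 1) * q * N)) J₂b≡ ⟩
    J₂ * b * ((c + 1) * q * N)       ≡⟨ regroup J₂ b c q N ⟩
    J₂ * (b * (c + 1) * q * N)       ∎
    where
    collect : ∀ s c q n → 2 * s * (6 * ((c + 1) * q)) * n ≡ 12 * s * ((c + 1) * q * n)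
    collect = solve-∀
    regroup : ∀ j b c q n → j * b * ((c + 1) * q * n) ≡ j * (b * (c + 1) * q * n)
    regroup = solve-∀

  46s≡2s23 : ∀ s → 46 * s ≡ 2 * s * 23
  46s≡2s23 = solve-∀

  wild : WildSolution m (6 * m + 6) (a * (c + 1) * N) (b * (c + 1) * q * N)
  wild = wildSolution m 6 (2 * s) J₁ J₂ _ _ (s≤s z≤n)
    (≤-trans (m≤m+n 6 6) (*-monoʳ-≤ 12 1≤m)) (*-monoʳ-≤ 2 1≤s) 1≤J₁ 1≤J₂
    -- For `k = 6` the factor `4 * k ∸ 1` is 23, and `L = 2 * s`.
    (trans J₁+J₂≡46s (46s≡2s23 s))
    (trans (cong (gcd (2 * s)) coprime) (gcd-zeroʳ (2 * s)))
    D≡J₁n₂ D≡J₂n₃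

-- A common divisor of `x * n + k` and `n` also divides `k`. With `n = 3`, coprimality to 3 is
-- reduced to the residue.
coprime-*+ : ∀ x {k n} → Coprime k n → Coprime (x * n + k) n
coprime-*+ x coprime (d∣xn+k , d∣n) = coprime (∣m+n∣m⇒∣n d∣xn+k (∣n⇒∣m*n x d∣n) , d∣n)

theorem4p1 : (m : ℕ) → 1 ≤ m →
  ((r c : ℕ) → m ≡ 46 * r + 14 + c * (46 * r + 15) →
    let n₂ = 4 * (3 * r + 1) * (c + 1) * (24 * m + 1)
        n₃ = 12 * (3 * r + 1) * (c + 1) * (46 * r + 15) * (24 * m + 1)
    in (4/ (24 * m + 1) ≡1/ (6 * m + 6) +1/ n₂ +1/ n₃) × WildSolution m (6 * m + 6) n₂ n₃)
  ×
  ((r c : ℕ) → 0 < r → m ≡ (138 * r ∸ 2) + c * (138 * r ∸ 1) →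
    let n₂ = 36 * r * (c + 1) * (24 * m + 1)
        n₃ = 36 * r * (c + 1) * (138 * r ∸ 1) * (24 * m + 1)
    in (4/ (24 * m + 1) ≡1/ (6 * m + 6) +1/ n₂ +1/ n₃) × WildSolution m (6 * m + 6) n₂ n₃)
  ×
  ((r c : ℕ) → m ≡ 138 * r + 90 + c * (138 * r + 91) →
    let n₂ = 12 * (3 * r + 2) * (c + 1) * (24 * m + 1)
        n₃ = 12 * (3 * r + 2) * (c + 1) * (138 * r + 91) * (24 * m + 1)
    in (4/ (24 * m + 1) ≡1/ (6 * m + 6) +1/ n₂ +1/ n₃) × WildSolution m (6 * m + 6) n₂ n₃)
  ×
  ((r c : ℕ) → m ≡ 138 * r + 42 + c * (138 * r + 43) →
    let n₂ = 12 * (3 * r + 1) * (c + 1) * (24 * m + 1)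
        n₃ = 4 * (3 * r + 1) * (c + 1) * (138 * r + 43) * (24 * m + 1)
    in (4/ (24 * m + 1) ≡1/ (6 * m + 6) +1/ n₂ +1/ n₃) × WildSolution m (6 * m + 6) n₂ n₃)
  ×
  ((r c : ℕ) → m ≡ 138 * r + 88 + c * (138 * r + 89) →
    let n₂ = 12 * (3 * r + 2) * (c + 1) * (24 * m + 1)
        n₃ = 4 * (3 * r + 2) * (c + 1) * (138 * r + 89) * (24 * m + 1)
    in (4/ (24 * m + 1) ≡1/ (6 * m + 6) +1/ n₂ +1/ n₃) × WildSolution m (6 * m + 6) n₂ n₃)
theorem4p1 m 1≤m = case1 , case2 , case3 , case4 , case5
  where
  1≤x+1+n : ∀ x n → 1 ≤ x + suc n
  1≤x+1+n x n = ≤-trans (s≤s z≤n) (m≤n+m (suc n) x)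

  case1 : (r c : ℕ) → m ≡ 46 * r + 14 + c * (46 * r + 15) → _
  -- For `s = 3 * r + 1` the number `46 * s - 1` is a multiple of 3, and `q` is a third of it. The
  -- factor 3 in `J₁ = 3 * q` is absorbed by `12 * s`, leaving `a = 4 * s`.
  case1 r c m≡ = wildSolution-k=6 (3 * r + 1) (3 * (46 * r + 15)) 1 (4 * (3 * r + 1)) (12 * (3 * r + 1))
    1≤m m≡ (+-assoc (46 * r) 14 1)
    (1≤x+1+n (3 * r) 0) (*-mono-≤ {1} {3} (s≤s z≤n) (1≤x+1+n (46 * r) 14)) ≤-refl
    (sum r) (gcd-zeroʳ (3 * (46 * r + 15))) (numerator r) (sym (*-identityˡ _))
    where
    sum : ∀ r → 3 * (46 * r + 15) + 1 ≡ 46 * (3 * r + 1)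
    sum = solve-∀
    numerator : ∀ r → 12 * (3 * r + 1) * (46 * r + 15) ≡ 3 * (46 * r + 15) * (4 * (3 * r + 1))
    numerator = solve-∀

  case2 : (r c : ℕ) → 0 < r → m ≡ (138 * r ∸ 2) + c * (138 * r ∸ 1) → _
  -- Here `s = 3 * r`, `J₁ = q = 46 * s - 1` and `J₂ = 1`. Positivity of `r` makes `s` positive and
  -- keeps both subtractions from truncating.
  case2 r c 0<r m≡ = wildSolution-k=6 (3 * r) q 1 (36 * r) (36 * r)
    1≤m m≡ p+1≡q
    (≤-trans 0<r (m≤m+n r _)) (subst (1 ≤_) p+1≡q (m≤n+m 1 p)) ≤-refl
    (trans q+1≡138r (*-assoc 46 3 r)) (gcd-zeroʳ q)
    (trans (cong (_* q) (sym (*-assoc 12 3 r))) (*-comm (36 * r) q))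
    (trans (sym (*-assoc 12 3 r)) (sym (*-identityˡ (36 * r))))
    where
    p = 138 * r ∸ 2
    q = 138 * r ∸ 1
    138≤138r : 138 ≤ 138 * r
    138≤138r = *-monoʳ-≤ 138 0<r
    q+1≡138r : q + 1 ≡ 138 * r
    q+1≡138r = m∸n+n≡m (≤-trans (m≤m+n 1 137) 138≤138r)
    p+1≡q : p + 1 ≡ q
    -- Both `p + 2` and `q + 1` restore `138 * r`, so the truncated differences are compared after
    -- adding 1.
    p+1≡q = +-cancelʳ-≡ 1 (p + 1) q (trans (+-assoc p 1 1)
      (trans (m∸n+n≡m (≤-trans (m≤m+n 2 136) 138≤138r)) (sym q+1≡138r)))

  case3 : (r c : ℕ) → m ≡ 138 * r + 90 + c * (138 * r + 91) → _
  -- The pattern of `case2` with `s = 3 * r + 2`: again `q + 1 = 46 * s`.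
  case3 r c m≡ = wildSolution-k=6 (3 * r + 2) (138 * r + 91) 1 (12 * (3 * r + 2)) (12 * (3 * r + 2))
    1≤m m≡ (+-assoc (138 * r) 90 1)
    (1≤x+1+n (3 * r) 1) (1≤x+1+n (138 * r) 90) ≤-refl
    (sum r) (gcd-zeroʳ (138 * r + 91)) (*-comm (12 * (3 * r + 2)) _) (sym (*-identityˡ _))
    where
    sum : ∀ r → 138 * r + 91 + 1 ≡ 46 * (3 * r + 2)
    sum = solve-∀

  case4 : (r c : ℕ) → m ≡ 138 * r + 42 + c * (138 * r + 43) → _
  case4 r c m≡ = wildSolution-k=6 (3 * r + 1) (138 * r + 43) 3 (12 * (3 * r + 1)) (4 * (3 * r + 1))
    1≤m m≡ (+-assoc (138 * r) 42 1)
    (1≤x+1+n (3 * r) 0) (1≤x+1+n (138 * r) 42) (s≤s z≤n)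
    -- Now `q + 3 = 46 * s` with `J₂ = 3`; coprimality holds because `q` is 1 modulo 3.
    (sum r) (coprime⇒gcd≡1 (subst (λ x → Coprime x 3) (mod3 r) (coprime-*+ (46 * r + 14) (gcd≡1⇒coprime {1} {3} refl))))
    (*-comm (12 * (3 * r + 1)) _) (*-assoc 3 4 (3 * r + 1))
    where
    sum : ∀ r → 138 * r + 43 + 3 ≡ 46 * (3 * r + 1)
    sum = solve-∀
    mod3 : ∀ r → (46 * r + 14) * 3 + 1 ≡ 138 * r + 43
    mod3 = solve-∀

  case5 : (r c : ℕ) → m ≡ 138 * r + 88 + c * (138 * r + 89) → _
  case5 r c m≡ = wildSolution-k=6 (3 * r + 2) (138 * r + 89) 3 (12 * (3 * r + 2)) (4 * (3 * r + 2))
    1≤m m≡ (+-assoc (138 * r) 88 1)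
    (1≤x+1+n (3 * r) 1) (1≤x+1+n (138 * r) 88) (s≤s z≤n)
    -- As in `case4`, with `q` now 2 modulo 3.
    (sum r) (coprime⇒gcd≡1 (subst (λ x → Coprime x 3) (mod3 r) (coprime-*+ (46 * r + 29) (gcd≡1⇒coprime {2} {3} refl))))
    (*-comm (12 * (3 * r + 2)) _) (*-assoc 3 4 (3 * r + 2))
    where
    sum : ∀ r → 138 * r + 89 + 3 ≡ 46 * (3 * r + 2)
    sum = solve-∀
    mod3 : ∀ r → (46 * r + 29) * 3 + 2 ≡ 138 * r + 89
    mod3 = solve-∀
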